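{- For each $m\in\{5,6,\ldots,17\}$, every one-solution (single-solution) ordinal algorithm for makespan minimization on $m$ identical machines has a competitive ratio of at least $R_m$, where $R_5=\frac{155}{107}$ $(\approx 1.448598)$, $R_6=\frac{191}{131}$, $R_7=\frac{1127}{767}$, $R_8=\frac{2278}{1543}$, $R_9=\frac{2593}{1753}$, $R_{10}=\frac{257}{173}$, $R_{11}=\frac{341}{229}$, $R_{12}=\frac{1873}{1257}$, $R_{13}=\frac{7449}{4985}$, $R_{14}=\frac{201739}{134815}$, $R_{15}=\frac{217183}{145111}$, $R_{16}=\frac{2027686}{1352011}$, $R_{17}=1.5$.
   Context: Ordinal makespan scheduling on $m$ identical machines. Jobs are indexed by positive integers. A realization is a sequence of real job sizes $p_1\ge p_2\ge p_3\ge\cdots\ge 0$ with only finitely many positive sizes. A solution is a partition of the set of all positive integers into $m$ sets $J_1,\dots,J_m$ (some may be empty), where $J_i$ is the set of jobs assigned to machine $i$; it is fixed without knowledge of the realization. For a realization, the load of machine $i$ in the solution is $\sum_{j\in J_i}p_j$, and the completion time of the solution is the maximum load of any machine. A one-solution ordinal algorithm consists of a single solution. The optimal offline completion time $\lambda$ of a realization is the minimum completion time over all solutions (chosen with full knowledge of the realization). The competitive ratio of the algorithm is the supremum, over all realizations with $\lambda>0$, of the ratio between the completion time of its solution and $\lambda$. -}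

module Defs where

open import Data.Bool.Base using (if_then_else_)
open import Data.Fin.Base using (Fin; toℕ)
import Data.Fin.Properties as Fin
open import Data.Integer.Base using (+_)
open import Data.Nat.Base as ℕ using (ℕ; suc)
import Data.Nat.Properties as ℕ
open import Data.Product.Base using (∃; ∃-syntax; _×_; _,_; proj₁; proj₂)
open import Data.Rational.Base as ℚ using (ℚ; 0ℚ; 1ℚ; _/_)
import Data.Rational.Properties as ℚ
open import Data.Rational.Solver using (module +-*-Solver)
open import Data.Sum.Base using (inj₁; inj₂)
open import Data.Vec.Functional using (foldr)
open import Relation.Binary.PropositionalEquality
open import Relation.Nullary.Decidable.Core using (does)

------------------------------------------------------------------------
-- Real numbers, as Cauchy sequences of rationals compared up to _≈ᴿ_

Cauchy : (ℕ → ℚ) → Set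
Cauchy x = ∀ ε → 0ℚ ℚ.< ε →
  ∃[ N ] (∀ i j → N ℕ.≤ i → N ℕ.≤ j → ℚ.∣ x i ℚ.- x j ∣ ℚ.≤ ε)

record ℝ : Set where
  constructor mkℝ
  field
    seq    : ℕ → ℚ
    cauchy : Cauchy seq

open ℝ public

infix 4 _≤ᴿ_ _<ᴿ_ _≈ᴿ_

_≤ᴿ_ : ℝ → ℝ → Set
x ≤ᴿ y = ∀ ε → 0ℚ ℚ.< ε → ∃[ N ] (∀ n → N ℕ.≤ n → seq x n ℚ.≤ seq y n ℚ.+ ε)

_<ᴿ_ : ℝ → ℝ → Set
x <ᴿ y = ∃[ ε ] 0ℚ ℚ.< ε × ∃[ N ] (∀ n → N ℕ.≤ n → seq x n ℚ.+ ε ℚ.≤ seq y n)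

_≈ᴿ_ : ℝ → ℝ → Set
x ≈ᴿ y = x ≤ᴿ y × y ≤ᴿ x

module Closure where

  open +-*-Solver using (solve; _:+_; _:*_; :-_; _:-_; _:=_)

  p≤q+∣p-q∣ : ∀ p q → p ℚ.≤ q ℚ.+ ℚ.∣ p ℚ.- q ∣
  p≤q+∣p-q∣ p q = begin
    p                          ≡⟨ solve 2 (λ p q → p := q :+ (p :- q)) refl p q ⟩
    q ℚ.+ (p ℚ.- q)            ≤⟨ ℚ.+-monoʳ-≤ q (p≤∣p∣ (p ℚ.- q)) ⟩
    q ℚ.+ ℚ.∣ p ℚ.- q ∣        ∎
    where
    open ℚ.≤-Reasoning
    p≤∣p∣ : ∀ p → p ℚ.≤ ℚ.∣ p ∣
    p≤∣p∣ p with ℚ.≤-total 0ℚ p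
    ... | inj₁ 0≤p = ℚ.≤-reflexive (sym (ℚ.0≤p⇒∣p∣≡p 0≤p))
    ... | inj₂ p≤0 = ℚ.≤-trans p≤0 (ℚ.0≤∣p∣ p)

  ∣p-q∣≤ε⇒p≤q+ε : ∀ p q {ε} → ℚ.∣ p ℚ.- q ∣ ℚ.≤ ε → p ℚ.≤ q ℚ.+ ε
  ∣p-q∣≤ε⇒p≤q+ε p q h = ℚ.≤-trans (p≤q+∣p-q∣ p q) (ℚ.+-monoʳ-≤ q h)

  p≤q+ε⇒p-q≤ε : ∀ p q ε → p ℚ.≤ q ℚ.+ ε → p ℚ.- q ℚ.≤ ε
  p≤q+ε⇒p-q≤ε p q ε h = subst (p ℚ.- q ℚ.≤_)
    (solve 2 (λ q ε → (q :+ ε) :- q := ε) refl q ε) (ℚ.+-monoˡ-≤ (ℚ.- q) h)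

  within : ∀ p q {ε} → p ℚ.≤ q ℚ.+ ε → q ℚ.≤ p ℚ.+ ε → ℚ.∣ p ℚ.- q ∣ ℚ.≤ ε
  within p q {ε} h k with ℚ.∣p∣≡p∨∣p∣≡-p (p ℚ.- q)
  ... | inj₁ e = subst (ℚ._≤ ε) (sym e) (p≤q+ε⇒p-q≤ε p q ε h)
  ... | inj₂ e = subst (ℚ._≤ ε)
    (sym (trans e (solve 2 (λ p q → :- (p :- q) := q :- p) refl p q)))
    (p≤q+ε⇒p-q≤ε q p ε k)

  ⊔-within : ∀ p q r s {ε} → ℚ.∣ p ℚ.- r ∣ ℚ.≤ ε → ℚ.∣ q ℚ.- s ∣ ℚ.≤ ε →
             p ℚ.⊔ q ℚ.≤ (r ℚ.⊔ s) ℚ.+ ε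
  ⊔-within p q r s {ε} h k = ℚ.⊔-lub
    (ℚ.≤-trans (∣p-q∣≤ε⇒p≤q+ε p r h) (ℚ.+-monoˡ-≤ ε (ℚ.p≤p⊔q r s)))
    (ℚ.≤-trans (∣p-q∣≤ε⇒p≤q+ε q s k) (ℚ.+-monoˡ-≤ ε (ℚ.p≤q⊔p r s)))

  bound : (x : ℝ) → ∃[ B ] 0ℚ ℚ.< B × ∃[ N ] (∀ n → N ℕ.≤ n → ℚ.∣ seq x n ∣ ℚ.≤ B)
  bound x with cauchy x 1ℚ (ℚ.positive⁻¹ 1ℚ)
  ... | N , h = B , 0<B , N , λ n N≤n → begin
      ℚ.∣ seq x n ∣
        ≡⟨ cong ℚ.∣_∣ (solve 2 (λ p q → p := q :+ (p :- q)) refl (seq x n) c) ⟩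
      ℚ.∣ c ℚ.+ (seq x n ℚ.- c) ∣
        ≤⟨ ℚ.∣p+q∣≤∣p∣+∣q∣ c (seq x n ℚ.- c) ⟩
      ℚ.∣ c ∣ ℚ.+ ℚ.∣ seq x n ℚ.- c ∣
        ≤⟨ ℚ.+-monoʳ-≤ ℚ.∣ c ∣ (h n N N≤n ℕ.≤-refl) ⟩
      B ∎
    where
    open ℚ.≤-Reasoning
    c B : ℚ
    c = seq x N
    B = ℚ.∣ c ∣ ℚ.+ 1ℚ
    0<B : 0ℚ ℚ.< B
    0<B = ℚ.+-mono-≤-< (ℚ.0≤∣p∣ c) (ℚ.positive⁻¹ 1ℚ)

  *-mono-∣∣ : ∀ p q {r s} → ℚ.∣ p ∣ ℚ.≤ r → ℚ.∣ q ∣ ℚ.≤ s →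
              ℚ.∣ p ℚ.* q ∣ ℚ.≤ r ℚ.* s
  *-mono-∣∣ p q {r} {s} h k = begin
    ℚ.∣ p ℚ.* q ∣        ≡⟨ ℚ.∣p*q∣≡∣p∣*∣q∣ p q ⟩
    ℚ.∣ p ∣ ℚ.* ℚ.∣ q ∣  ≤⟨ ℚ.*-monoʳ-≤-nonNeg ℚ.∣ q ∣ {{ℚ.nonNegative (ℚ.0≤∣p∣ q)}} h ⟩
    r ℚ.* ℚ.∣ q ∣        ≤⟨ ℚ.*-monoˡ-≤-nonNeg r {{ℚ.nonNegative (ℚ.≤-trans (ℚ.0≤∣p∣ p) h)}} k ⟩
    r ℚ.* s              ∎
    where open ℚ.≤-Reasoning

  abstract
    +-cauchy : (x y : ℝ) → Cauchy (λ n → seq x n ℚ.+ seq y n)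
    +-cauchy x y ε 0<ε with cauchy x (ℚ.½ ℚ.* ε) 0<ε/2 | cauchy y (ℚ.½ ℚ.* ε) 0<ε/2
      where
      0<ε/2 : 0ℚ ℚ.< ℚ.½ ℚ.* ε
      0<ε/2 = ℚ.positive⁻¹ _ {{ℚ.pos*pos⇒pos ℚ.½ ε {{ℚ.positive 0<ε}}}}
    ... | M , h | N , k = M ℕ.⊔ N , λ i j i≥ j≥ → begin
        ℚ.∣ (a i ℚ.+ b i) ℚ.- (a j ℚ.+ b j) ∣
          ≡⟨ cong ℚ.∣_∣ (solve 4 (λ a b c d → (a :+ b) :- (c :+ d) := (a :- c) :+ (b :- d))
               refl (a i) (b i) (a j) (b j)) ⟩
        ℚ.∣ (a i ℚ.- a j) ℚ.+ (b i ℚ.- b j) ∣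
          ≤⟨ ℚ.∣p+q∣≤∣p∣+∣q∣ (a i ℚ.- a j) (b i ℚ.- b j) ⟩
        ℚ.∣ a i ℚ.- a j ∣ ℚ.+ ℚ.∣ b i ℚ.- b j ∣
          ≤⟨ ℚ.+-mono-≤
               (h i j (ℕ.m⊔n≤o⇒m≤o M N i≥) (ℕ.m⊔n≤o⇒m≤o M N j≥))
               (k i j (ℕ.m⊔n≤o⇒n≤o M N i≥) (ℕ.m⊔n≤o⇒n≤o M N j≥)) ⟩
        ℚ.½ ℚ.* ε ℚ.+ ℚ.½ ℚ.* ε
          ≡⟨ ℚ.*-distribʳ-+ ε ℚ.½ ℚ.½ ⟨
        1ℚ ℚ.* ε
          ≡⟨ ℚ.*-identityˡ ε ⟩
        ε ∎
      where
      open ℚ.≤-Reasoning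
      a b : ℕ → ℚ
      a = seq x
      b = seq y

  abstract
    ⊔-cauchy : (x y : ℝ) → Cauchy (λ n → seq x n ℚ.⊔ seq y n)
    ⊔-cauchy x y ε 0<ε with cauchy x ε 0<ε | cauchy y ε 0<ε
    ... | M , h | N , k = M ℕ.⊔ N , λ i j i≥ j≥ → within (a i ℚ.⊔ b i) (a j ℚ.⊔ b j)
        (close i j i≥ j≥) (close j i j≥ i≥)
      where
      a b : ℕ → ℚ
      a = seq x
      b = seq y
      close : ∀ i j → M ℕ.⊔ N ℕ.≤ i → M ℕ.⊔ N ℕ.≤ j →
              a i ℚ.⊔ b i ℚ.≤ (a j ℚ.⊔ b j) ℚ.+ ε
      close i j i≥ j≥ = ⊔-within (a i) (b i) (a j) (b j)
        (h i j (ℕ.m⊔n≤o⇒m≤o M N i≥) (ℕ.m⊔n≤o⇒m≤o M N j≥))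
        (k i j (ℕ.m⊔n≤o⇒n≤o M N i≥) (ℕ.m⊔n≤o⇒n≤o M N j≥))

  *-within : ∀ a b c d {A B δ} → ℚ.∣ a ∣ ℚ.≤ A → ℚ.∣ d ∣ ℚ.≤ B →
             ℚ.∣ a ℚ.- c ∣ ℚ.≤ δ → ℚ.∣ b ℚ.- d ∣ ℚ.≤ δ →
             ℚ.∣ a ℚ.* b ℚ.- c ℚ.* d ∣ ℚ.≤ (A ℚ.+ B) ℚ.* δ
  *-within a b c d {A} {B} {δ} ∣a∣≤A ∣d∣≤B h k = begin
    ℚ.∣ a ℚ.* b ℚ.- c ℚ.* d ∣
      ≡⟨ cong ℚ.∣_∣ (solve 4 (λ a b c d → a :* b :- c :* d := a :* (b :- d) :+ d :* (a :- c))
           refl a b c d) ⟩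
    ℚ.∣ a ℚ.* (b ℚ.- d) ℚ.+ d ℚ.* (a ℚ.- c) ∣
      ≤⟨ ℚ.∣p+q∣≤∣p∣+∣q∣ (a ℚ.* (b ℚ.- d)) (d ℚ.* (a ℚ.- c)) ⟩
    ℚ.∣ a ℚ.* (b ℚ.- d) ∣ ℚ.+ ℚ.∣ d ℚ.* (a ℚ.- c) ∣
      ≤⟨ ℚ.+-mono-≤ (*-mono-∣∣ a (b ℚ.- d) ∣a∣≤A k) (*-mono-∣∣ d (a ℚ.- c) ∣d∣≤B h) ⟩
    A ℚ.* δ ℚ.+ B ℚ.* δ
      ≡⟨ ℚ.*-distribʳ-+ δ A B ⟨
    (A ℚ.+ B) ℚ.* δ ∎
    where open ℚ.≤-Reasoning

  divide : ∀ C ε → 0ℚ ℚ.< C → 0ℚ ℚ.< ε → ∃[ δ ] 0ℚ ℚ.< δ × C ℚ.* δ ≡ ε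
  divide C ε 0<C 0<ε = I ℚ.* ε , 0<δ , (begin
    C ℚ.* (I ℚ.* ε)  ≡⟨ ℚ.*-assoc C I ε ⟨
    C ℚ.* I ℚ.* ε    ≡⟨ cong (ℚ._* ε) (ℚ.*-inverseʳ C) ⟩
    1ℚ ℚ.* ε         ≡⟨ ℚ.*-identityˡ ε ⟩
    ε                ∎)
    where
    open ≡-Reasoning
    instance
      C>0 : ℚ.Positive C
      C>0 = ℚ.positive 0<C
      C≢0 : ℚ.NonZero C
      C≢0 = ℚ.pos⇒nonZero C
    I : ℚ
    I = ℚ.1/ C
    0<δ : 0ℚ ℚ.< I ℚ.* ε
    0<δ = ℚ.positive⁻¹ _ {{ℚ.pos*pos⇒pos I {{ℚ.1/pos⇒pos C}} ε {{ℚ.positive 0<ε}}}}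

  Near : (ℕ → ℚ) → ℚ → Set
  Near x ε = ∃[ N ] (∀ i j → N ℕ.≤ i → N ℕ.≤ j → ℚ.∣ x i ℚ.- x j ∣ ℚ.≤ ε)

  Bounded : (ℕ → ℚ) → ℚ → Set
  Bounded x B = ∃[ N ] (∀ n → N ℕ.≤ n → ℚ.∣ x n ∣ ℚ.≤ B)

  *-near : ∀ {x y A B δ} → Bounded x A → Bounded y B → Near x δ → Near y δ →
           Near (λ n → x n ℚ.* y n) ((A ℚ.+ B) ℚ.* δ)
  *-near {x} {y} (K , f) (L , g) (M , h) (N , k) =
    K ℕ.⊔ L ℕ.⊔ (M ℕ.⊔ N) , λ i j i≥ j≥ →
      let i≥₁ = ℕ.m⊔n≤o⇒m≤o (K ℕ.⊔ L) (M ℕ.⊔ N) i≥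
          j≥₁ = ℕ.m⊔n≤o⇒m≤o (K ℕ.⊔ L) (M ℕ.⊔ N) j≥
          i≥₂ = ℕ.m⊔n≤o⇒n≤o (K ℕ.⊔ L) (M ℕ.⊔ N) i≥
          j≥₂ = ℕ.m⊔n≤o⇒n≤o (K ℕ.⊔ L) (M ℕ.⊔ N) j≥
      in *-within (x i) (y i) (x j) (y j)
           (f i (ℕ.m⊔n≤o⇒m≤o K L i≥₁)) (g j (ℕ.m⊔n≤o⇒n≤o K L j≥₁))
           (h i j (ℕ.m⊔n≤o⇒m≤o M N i≥₂) (ℕ.m⊔n≤o⇒m≤o M N j≥₂))
           (k i j (ℕ.m⊔n≤o⇒n≤o M N i≥₂) (ℕ.m⊔n≤o⇒n≤o M N j≥₂))

  abstract
    *-cauchy : (x y : ℝ) → Cauchy (λ n → seq x n ℚ.* seq y n)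
    *-cauchy x y ε 0<ε = go (bound x) (bound y)
      where
      go : (∃[ A ] 0ℚ ℚ.< A × Bounded (seq x) A) → (∃[ B ] 0ℚ ℚ.< B × Bounded (seq y) B) →
           Near (λ n → seq x n ℚ.* seq y n) ε
      go (A , 0<A , f) (B , 0<B , g) =
        let δ , 0<δ , eq = divide (A ℚ.+ B) ε (ℚ.+-mono-< 0<A 0<B) 0<ε
        in subst (Near (λ n → seq x n ℚ.* seq y n)) eq
             (*-near {x = seq x} {y = seq y} {A = A} {B = B} {δ = δ}
               f g (cauchy x δ 0<δ) (cauchy y δ 0<δ))

open Closure using (+-cauchy; *-cauchy; ⊔-cauchy)

fromℚ : ℚ → ℝ
fromℚ q = mkℝ (λ _ → q) λ ε 0<ε → 0 , λ _ _ _ _ →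
  subst (λ d → ℚ.∣ d ∣ ℚ.≤ ε) (sym (ℚ.+-inverseʳ q)) (ℚ.<⇒≤ 0<ε)

0ᴿ : ℝ
0ᴿ = fromℚ 0ℚ

infixl 6 _+ᴿ_ _⊔ᴿ_
infixl 7 _*ᴿ_

_+ᴿ_ _*ᴿ_ _⊔ᴿ_ : ℝ → ℝ → ℝ
x +ᴿ y = mkℝ (λ n → seq x n ℚ.+ seq y n) (+-cauchy x y)
x *ᴿ y = mkℝ (λ n → seq x n ℚ.* seq y n) (*-cauchy x y)
x ⊔ᴿ y = mkℝ (λ n → seq x n ℚ.⊔ seq y n) (⊔-cauchy x y)

-- a ≤ sup S, where sup S = +∞ when S is unbounded: everything strictly below
-- a is exceeded by an element of S.
infix 4 _≤sup_

_≤sup_ : ℝ → (ℝ → Set) → Set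
a ≤sup S = ∀ x → x <ᴿ a → ∃[ s ] S s × x <ᴿ s

------------------------------------------------------------------------
-- Ordinal scheduling

-- Jobs are indexed from 0, so that j stands for the (j+1)-st largest job.
Job : Set
Job = ℕ

-- Sizes are nonincreasing and nonnegative, so having finitely many positive
-- ones means that they vanish from some index on; any such index may be used
-- as `support`.
record Realization : Set where
  field
    size        : Job → ℝ
    decreasing  : ∀ j → size (suc j) ≤ᴿ size j
    nonnegative : ∀ j → 0ᴿ ≤ᴿ size j
    support     : ℕ
    vanishing   : ∀ j → support ℕ.≤ j → size j ≈ᴿ 0ᴿ

open Realization public

-- A partition of the jobs into J₁, …, Jₘ, given by the map sending a job to
-- the index of its class: Jᵢ = { j ∣ σ j ≡ i }.
Solution : ℕ → Set
Solution m = Job → Fin m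

module _ {m : ℕ} where

  -- The sum over Jᵢ, restricted to jobs below the support; the rest have size 0.
  load : Solution m → Realization → Fin m → ℝ
  load σ r i = foldr _+ᴿ_ 0ᴿ {support r} λ j →
    if does (σ (toℕ j) Fin.≟ i) then size r (toℕ j) else 0ᴿ

  -- Loads are nonnegative, so starting the maximum at 0 is harmless.
  completionTime : Solution m → Realization → ℝ
  completionTime σ r = foldr _⊔ᴿ_ 0ᴿ (load σ r)

-- The minimum completion time over all solutions on m machines is λ*.
IsOptimum : ℕ → Realization → ℝ → Set
IsOptimum m r λ* =
  (∃[ τ ] completionTime {m} τ r ≈ᴿ λ*) × (∀ τ → λ* ≤ᴿ completionTime {m} τ r)

-- The set whose supremum is the competitive ratio of σ.
Ratio : ∀ {m} → Solution m → ℝ → Set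
Ratio {m} σ ρ = ∃[ r ] ∃[ λ* ]
  IsOptimum m r λ* × 0ᴿ <ᴿ λ* × ρ *ᴿ λ* ≈ᴿ completionTime σ r

CompetitiveRatioAtLeast : ∀ {m} → ℝ → Solution m → Set
CompetitiveRatioAtLeast a σ = a ≤sup Ratio σ

-- Only the values at 5, …, 17 are meaningful.
R : ℕ → ℚ
R 5  = + 155 / 107
R 6  = + 191 / 131
R 7  = + 1127 / 767
R 8  = + 2278 / 1543
R 9  = + 2593 / 1753
R 10 = + 257 / 173
R 11 = + 341 / 229
R 12 = + 1873 / 1257
R 13 = + 7449 / 4985
R 14 = + 201739 / 134815
R 15 = + 217183 / 145111
R 16 = + 2027686 / 1352011
R 17 = + 3 / 2
R _  = 0ℚ

-- If the ratio of σ is below 3/2, its first 2m jobs are folded: job a < m shares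
-- its machine with job 2m - 1 - a. Then every machine is attacked with sand, that
-- is, with a large number of equal tiny jobs. Let x be the target ratio. In the
-- realizations with
--   a + 1 jobs of size 1 and sand of total size m - 1 - a,
--   2m - a jobs of size 1/2 and sand of total size a/2, or
--   only sand, of total size m,
-- the optimum is 1, and up to a vanishing error the machine of job a exceeds load x
-- unless it has at most a fraction (x-1)/(m-1-a), 2(x-1)/a or x/m of the sand. R m
-- is chosen such that for x = R m the least of these bounds sum to at most 1 over a.

module Submission where

open import Defs
open import Algebra.Properties.Semiring.Sum as ∑ using ()
open import Data.Bool.Base using (true; false; if_then_else_)
open import Data.Fin.Base as Fin using (Fin; zero; suc; toℕ; fromℕ<; punchOut)
import Data.Fin.Properties as Fin
open import Data.Integer.Base as ℤ using (∣_∣)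
import Data.Integer.Properties as ℤ
open import Data.Nat.Base
open import Data.Nat.Coprimality as Coprime using (1-coprimeTo)
open import Data.Nat.Divisibility
open import Data.Nat.DivMod
open import Data.Nat.Properties
open import Data.Nat.Induction using (<-rec)
open import Data.Nat.Solver using (module +-*-Solver)
open import Data.Product.Base using (∃-syntax; _×_; _,_; proj₁; proj₂)
open import Data.Rational.Base as ℚ using (ℚ; mkℚ; 0ℚ; ½; ↥_; ↧ₙ_; toℚᵘ)
import Data.Rational.Properties as ℚ
open import Data.Rational.Unnormalised.Base as ℚᵘ using (mkℚᵘ; *≡*; *≤*)
import Data.Rational.Unnormalised.Properties as ℚᵘ
open import Data.Sum.Base using (inj₁; inj₂)
open import Data.Vec.Functional using (foldr)
open import Function.Base using (_∘_; const)
open import Relation.Binary.Definitions using (tri<; tri≈; tri>)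
open import Relation.Binary.PropositionalEquality
open import Relation.Nullary.Decidable using (Dec; yes; no; does; dec-true; dec-false; _×-dec_; toWitness)
open import Relation.Nullary.Negation using (¬_; contradiction)

open ∑ +-*-semiring using (sum; sum-cong-≗; ∑-distrib-+; ∑-comm; *-distribˡ-sum)

-- Finite sums of natural numbers

sum-const : ∀ n c → sum {n} (const c) ≡ n * c
sum-const zero    c = refl
sum-const (suc n) c = cong (c +_) (sum-const n c)

sum-mono : ∀ {n} {f g : Fin n → ℕ} → (∀ i → f i ≤ g i) → sum f ≤ sum g
sum-mono {zero}  f≤g = z≤n
sum-mono {suc n} f≤g = +-mono-≤ (f≤g zero) (sum-mono (f≤g ∘ suc))

term≤sum : ∀ {n} (f : Fin n → ℕ) i → f i ≤ sum f
term≤sum f zero    = m≤m+n _ _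
term≤sum f (suc i) = ≤-trans (term≤sum (f ∘ suc) i) (m≤n+m _ (f zero))

sum-<⇒∃< : ∀ {n} (f g : Fin n → ℕ) → sum f < sum g → ∃[ i ] f i < g i
sum-<⇒∃< {suc n} f g ∑f<∑g with f zero <? g zero
... | yes f₀<g₀ = zero , f₀<g₀
... | no  f₀≮g₀ =
  let i , fᵢ<gᵢ = sum-<⇒∃< (f ∘ suc) (g ∘ suc) (≰⇒> λ ∑g≤∑f →
        <⇒≱ ∑f<∑g (+-mono-≤ (≮⇒≥ f₀≮g₀) ∑g≤∑f))
  in suc i , fᵢ<gᵢ

∑< : ℕ → (ℕ → ℕ) → ℕ
∑< n f = sum {n} (f ∘ toℕ)

∑<-suc : ∀ n f → ∑< (suc n) f ≡ ∑< n f + f n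
∑<-suc zero    f = +-identityʳ (f 0)
∑<-suc (suc n) f =
  trans (cong (f 0 +_) (∑<-suc n (f ∘ suc))) (sym (+-assoc (f 0) _ _))

∑<-mono : ∀ {m n} f g → m ≤ n → (∀ j → j < m → f j ≤ g j) → ∑< m f ≤ ∑< n g
∑<-mono f g z≤n       f≤g = z≤n
∑<-mono f g (s≤s m≤n) f≤g =
  +-mono-≤ (f≤g 0 z<s) (∑<-mono (f ∘ suc) (g ∘ suc) m≤n λ j j<m → f≤g (suc j) (s<s j<m))

∑<-extend : ∀ {m n} f → m ≤ n → ∑< m f ≤ ∑< n f
∑<-extend f m≤n = ∑<-mono f f m≤n λ _ _ → ≤-refl

-- Solutions on natural-number sizes, restricted to the first n jobs

module _ {m : ℕ} where

  share : Solution m → (Job → ℕ) → Fin m → Job → ℕ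
  share σ p i j = if does (σ j Fin.≟ i) then p j else 0

  loadℕ : Solution m → (Job → ℕ) → ℕ → Fin m → ℕ
  loadℕ σ p n i = ∑< n (share σ p i)

  makespan : Solution m → (Job → ℕ) → ℕ → ℕ
  makespan σ p n = foldr _⊔_ 0 (loadℕ σ p n)

  count : Solution m → ℕ → Fin m → ℕ
  count σ = loadℕ σ (const 1)

  share-hit : ∀ σ p {i j} → σ j ≡ i → share σ p i j ≡ p j
  share-hit σ p {i} {j} hit =
    cong (λ b → if b then p j else 0) (dec-true (σ j Fin.≟ i) hit)

  -- Every job below `n` is counted at least once; `f` may hit a machine several times, hence only
  -- an inequality. This serves both the averaging bound and the distribution of the sand.
  total≤loads : ∀ {l} σ p n (f : Fin l → Fin m) → (∀ j → ∃[ a ] f a ≡ σ j) →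
                ∑< n p ≤ sum (loadℕ σ p n ∘ f)
  total≤loads σ p n f covers = begin
    ∑< n p                                             ≤⟨ sum-mono {n} hit ⟩
    sum (λ j → sum (λ a → share σ p (f a) (toℕ {n} j))) ≡⟨ ∑-comm (λ j a → share σ p (f a) (toℕ {n} j)) ⟩
    sum (loadℕ σ p n ∘ f)                              ∎
    where
    open ≤-Reasoning
    hit : ∀ j → p (toℕ j) ≤ sum (λ a → share σ p (f a) (toℕ j))
    hit j with a , fa≡σj ← covers (toℕ j) = begin
      p (toℕ j)                           ≡⟨ share-hit σ p (sym fa≡σj) ⟨
      share σ p (f a) (toℕ j)             ≤⟨ term≤sum (λ a → share σ p (f a) (toℕ j)) a ⟩
      sum (λ a → share σ p (f a) (toℕ j)) ∎

  count-hit : ∀ σ {n i j} → j < n → σ j ≡ i → suc (count σ j i) ≤ count σ n i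
  count-hit σ {n} {i} {j} j<n hit = begin
    suc (count σ j i)                       ≡⟨ +-comm 1 _ ⟩
    count σ j i + 1                         ≡⟨ cong (count σ j i +_) (share-hit σ (const 1) hit) ⟨
    count σ j i + share σ (const 1) i j     ≡⟨ ∑<-suc j (share σ (const 1) i) ⟨
    count σ (suc j) i                       ≤⟨ ∑<-extend (share σ (const 1) i) j<n ⟩
    count σ n i                             ∎
    where open ≤-Reasoning

-- Maxima, the averaging bound and packing

foldr⊔-upper : ∀ {n} (f : Fin n → ℕ) i → f i ≤ foldr _⊔_ 0 f
foldr⊔-upper f zero    = m≤m⊔n _ _
foldr⊔-upper f (suc i) = ≤-trans (foldr⊔-upper (f ∘ suc) i) (m≤n⊔m (f zero) _)

foldr⊔-least : ∀ {n} (f : Fin n → ℕ) {c} → (∀ i → f i ≤ c) → foldr _⊔_ 0 f ≤ c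
foldr⊔-least {zero}  f f≤c = z≤n
foldr⊔-least {suc n} f f≤c = ⊔-lub (f≤c zero) (foldr⊔-least (f ∘ suc) (f≤c ∘ suc))

module _ {m : ℕ} .{{_ : NonZero m}} where

  average≤makespan : ∀ {p n c} → ∑< n p ≡ m * c → (σ : Solution m) → c ≤ makespan σ p n
  average≤makespan {p} {n} {c} total σ = *-cancelˡ-≤ m (begin
    m * c                            ≡⟨ total ⟨
    ∑< n p                           ≤⟨ total≤loads σ p n (λ i → i) (λ j → σ j , refl) ⟩
    sum (loadℕ σ p n)                ≤⟨ sum-mono (foldr⊔-upper (loadℕ σ p n)) ⟩
    sum {m} (const (makespan σ p n)) ≡⟨ sum-const m _ ⟩
    m * makespan σ p n               ∎)
    where open ≤-Reasoning

  -- Lay the jobs end to end on a line cut into m intervals of length c. By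
  -- divisibility no job straddles a cut.
  module Packing (p : Job → ℕ) (n c : ℕ) .{{_ : NonZero c}}
                 (positive : ∀ j → j < n → 0 < p j)
                 (p∣prefix : ∀ j → j < n → p j ∣ ∑< j p)
                 (p∣c : ∀ j → j < n → p j ∣ c)
                 (total : ∑< n p ≤ m * c) where

    -- Job `j` goes to the interval in which it starts. Reduction modulo `m` only makes `τ` total:
    -- below `n` the quotient is already less than `m`.
    τ : Solution m
    τ j = (∑< j p / c) mod m

    -- The start of the job and the next cut are both multiples of `p j`, and the start is strictly
    -- smaller, so they differ by at least `p j`.
    step-in-cell : ∀ j → j < n → ∑< j p + p j ≤ c + (∑< j p / c) * c
    step-in-cell j j<n with p∣prefix j j<n | ∣m∣n⇒∣m+n (p∣c j j<n) (∣n⇒∣m*n (∑< j p / c) (p∣c j j<n))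
    ... | divides x P≡xp | divides y Q≡yp = begin
      ∑< j p + p j        ≡⟨ cong (_+ p j) P≡xp ⟩
      x * p j + p j       ≡⟨ +-comm (x * p j) (p j) ⟩
      suc x * p j         ≤⟨ *-monoˡ-≤ (p j) x<y ⟩
      y * p j             ≡⟨ Q≡yp ⟨
      c + (∑< j p / c) * c ∎
      where
      open ≤-Reasoning
      x<y : x < y
      x<y = *-cancelʳ-< (p j) x y (begin-strict
        x * p j                           ≡⟨ P≡xp ⟨
        ∑< j p                            ≡⟨ m≡m%n+[m/n]*n (∑< j p) c ⟩
        ∑< j p % c + (∑< j p / c) * c     <⟨ +-monoˡ-< _ (m%n<n (∑< j p) c) ⟩
        c + (∑< j p / c) * c              ≡⟨ Q≡yp ⟩
        y * p j                           ∎)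

    cell<m : ∀ j → j < n → ∑< j p / c < m
    cell<m j j<n = m<n*o⇒m/o<n (begin-strict
      ∑< j p         <⟨ m<m+n (∑< j p) (positive j j<n) ⟩
      ∑< j p + p j   ≡⟨ ∑<-suc j p ⟨
      ∑< (suc j) p   ≤⟨ ∑<-extend p j<n ⟩
      ∑< n p         ≤⟨ total ⟩
      m * c          ∎)
      where open ≤-Reasoning

    toℕ-τ : ∀ j → j < n → toℕ (τ j) ≡ ∑< j p / c
    toℕ-τ j j<n = trans (Fin.toℕ-fromℕ< _) (m<n⇒m%n≡m (cell<m j j<n))

    -- The bound is the part of interval `i` to the left of the prefix sum. The cap `c` alone would
    -- not carry the induction: placing a job requires knowing how far its interval is filled.
    load-bound : ∀ j → j ≤ n → ∀ i → loadℕ τ p j i ≤ (∑< j p ∸ toℕ i * c) ⊓ c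
    load-bound zero    _   i = z≤n
    load-bound (suc j) j<n i
      rewrite ∑<-suc j (share τ p i) | ∑<-suc j p with τ j Fin.≟ i
    ... | no _ = begin
      loadℕ τ p j i + 0                ≡⟨ +-identityʳ _ ⟩
      loadℕ τ p j i                    ≤⟨ load-bound j (<⇒≤ j<n) i ⟩
      (∑< j p ∸ toℕ i * c) ⊓ c         ≤⟨ ⊓-monoˡ-≤ c (∸-monoˡ-≤ (toℕ i * c) (m≤m+n _ (p j))) ⟩
      (∑< j p + p j ∸ toℕ i * c) ⊓ c   ∎
      where open ≤-Reasoning
    ... | yes refl rewrite toℕ-τ j j<n = begin
      loadℕ τ p j (τ j) + p j  ≤⟨ +-monoˡ-≤ (p j) (load-bound j (<⇒≤ j<n) (τ j)) ⟩
      (∑< j p ∸ toℕ (τ j) * c) ⊓ c + p j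
                               ≤⟨ +-monoˡ-≤ (p j) (m⊓n≤m _ c) ⟩
      ∑< j p ∸ toℕ (τ j) * c + p j
                               ≡⟨ cong (λ x → ∑< j p ∸ x * c + p j) (toℕ-τ j j<n) ⟩
      ∑< j p ∸ q*c + p j       ≡⟨ +-∸-comm (p j) (m/n*n≤m (∑< j p) c) ⟨
      ∑< j p + p j ∸ q*c       ≤⟨ ⊓-glb ≤-refl (m≤n+o⇒m∸n≤o (∑< j p + p j) q*c
                                    (≤-trans (step-in-cell j j<n) (≤-reflexive (+-comm c q*c)))) ⟩
      (∑< j p + p j ∸ q*c) ⊓ c ∎
      where
      open ≤-Reasoning
      q*c : ℕ
      q*c = (∑< j p / c) * c

    makespan≤c : makespan τ p n ≤ c
    makespan≤c = foldr⊔-least (loadℕ τ p n) λ i →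
      ≤-trans (load-bound n ≤-refl i) (m⊓n≤n _ c)

-- Realizations with natural-number sizes

-- The explicit denominator 1 keeps numerator and denominator visible to computation, whereas `_/_`
-- would normalise by a gcd that is stuck on a variable.
nat : ℕ → ℚ
nat n = mkℚ (ℤ.+ n) 0 (Coprime.sym (1-coprimeTo n))

nat-+ : ∀ a b → nat (a + b) ≡ nat a ℚ.+ nat b
nat-+ a b = ℚ.toℚᵘ-injective (ℚᵘ.≃-trans
  (*≡* (cong (ℤ._* ℤ.1ℤ) (trans (ℤ.pos-+ a b)
    (sym (cong₂ ℤ._+_ (ℤ.*-identityʳ (ℤ.+ a)) (ℤ.*-identityʳ (ℤ.+ b)))))))
  (ℚᵘ.≃-sym (ℚ.toℚᵘ-homo-+ (nat a) (nat b))))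

nat-mono-≤ : ∀ {a b} → a ≤ b → nat a ℚ.≤ nat b
nat-mono-≤ a≤b = ℚ.*≤* (ℤ.*-monoʳ-≤-nonNeg ℤ.1ℤ (ℤ.+≤+ a≤b))

nat-⊔ : ∀ a b → nat (a ⊔ b) ≡ nat a ℚ.⊔ nat b
nat-⊔ a b with ≤-total a b
... | inj₁ a≤b = trans (cong nat (m≤n⇒m⊔n≡n a≤b)) (sym (ℚ.p≤q⇒p⊔q≡q (nat-mono-≤ a≤b)))
... | inj₂ b≤a = trans (cong nat (m≥n⇒m⊔n≡m b≤a)) (sym (ℚ.p≥q⇒p⊔q≡p (nat-mono-≤ b≤a)))

/-*-cancel : ∀ a c .{{_ : NonZero c}} → (ℤ.+ a ℚ./ c) ℚ.* nat c ≡ nat a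
/-*-cancel a (suc c) = ℚ.toℚᵘ-injective (begin
  toℚᵘ ((ℤ.+ a ℚ./ suc c) ℚ.* nat (suc c))
    ≈⟨ ℚ.toℚᵘ-homo-* (ℤ.+ a ℚ./ suc c) (nat (suc c)) ⟩
  toℚᵘ (ℤ.+ a ℚ./ suc c) ℚᵘ.* toℚᵘ (nat (suc c))
    ≈⟨ ℚᵘ.*-congʳ (ℚ.toℚᵘ-fromℚᵘ (mkℚᵘ (ℤ.+ a) c)) ⟩
  mkℚᵘ (ℤ.+ a) c ℚᵘ.* toℚᵘ (nat (suc c))
    ≈⟨ *≡* (trans (ℤ.*-identityʳ _)
         (cong (λ n → ℤ.+ a ℤ.* ℤ.+ n) (sym (*-identityʳ (suc c))))) ⟩
  toℚᵘ (nat a) ∎)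
  where open ℚᵘ.≃-Reasoning

p≤p+ε : ∀ p {ε} → 0ℚ ℚ.< ε → p ℚ.≤ p ℚ.+ ε
p≤p+ε p 0<ε =
  ℚ.≤-trans (ℚ.≤-reflexive (sym (ℚ.+-identityʳ p))) (ℚ.+-monoʳ-≤ p (ℚ.<⇒≤ 0<ε))

≤⇒≤ᴿ : ∀ {x y} → (∀ n → seq x n ℚ.≤ seq y n) → x ≤ᴿ y
≤⇒≤ᴿ {x} {y} x≤y ε 0<ε = 0 , λ n _ → ℚ.≤-trans (x≤y n) (p≤p+ε (seq y n) 0<ε)

≡⇒≈ᴿ : ∀ {x y} → (∀ n → seq x n ≡ seq y n) → x ≈ᴿ y
≡⇒≈ᴿ {x} {y} x≡y =
  ≤⇒≤ᴿ {x} {y} (ℚ.≤-reflexive ∘ x≡y) , ≤⇒≤ᴿ {y} {x} (ℚ.≤-reflexive ∘ sym ∘ x≡y)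

seq-sum : ∀ k {n} (xs : Fin n → ℝ) f → (∀ j → seq (xs j) k ≡ nat (f j)) →
          seq (foldr _+ᴿ_ 0ᴿ xs) k ≡ nat (sum f)
seq-sum k {zero}  xs f eq = refl
seq-sum k {suc n} xs f eq =
  trans (cong₂ ℚ._+_ (eq zero) (seq-sum k (xs ∘ suc) (f ∘ suc) (eq ∘ suc)))
        (sym (nat-+ (f zero) (sum (f ∘ suc))))

seq-max : ∀ k {n} (xs : Fin n → ℝ) f → (∀ j → seq (xs j) k ≡ nat (f j)) →
          seq (foldr _⊔ᴿ_ 0ᴿ xs) k ≡ nat (foldr _⊔_ 0 f)
seq-max k {zero}  xs f eq = refl
seq-max k {suc n} xs f eq =
  trans (cong₂ ℚ._⊔_ (eq zero) (seq-max k (xs ∘ suc) (f ∘ suc) (eq ∘ suc)))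
        (sym (nat-⊔ (f zero) (foldr _⊔_ 0 (f ∘ suc))))

module Integral (p : Job → ℕ) (n : ℕ)
                (p-decreasing : ∀ j → p (suc j) ≤ p j)
                (p-vanishing : ∀ j → n ≤ j → p j ≡ 0) where

  realization : Realization
  realization = record
    { size        = λ j → fromℚ (nat (p j))
    ; decreasing  = λ j → ≤⇒≤ᴿ {fromℚ (nat (p (suc j)))} {fromℚ (nat (p j))}
                            λ _ → nat-mono-≤ (p-decreasing j)
    ; nonnegative = λ j → ≤⇒≤ᴿ {0ᴿ} {fromℚ (nat (p j))} λ _ → nat-mono-≤ z≤n
    ; support     = n
    ; vanishing   = λ j n≤j → ≡⇒≈ᴿ {fromℚ (nat (p j))} {0ᴿ} λ _ → cong nat (p-vanishing j n≤j)
    }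

  module _ {m : ℕ} where

    seq-load : ∀ (σ : Solution m) i k → seq (load σ realization i) k ≡ nat (loadℕ σ p n i)
    seq-load σ i k = seq-sum k {n}
      (λ j → if does (σ (toℕ j) Fin.≟ i) then fromℚ (nat (p (toℕ j))) else 0ᴿ)
      (share σ p i ∘ toℕ) λ j → term (does (σ (toℕ j) Fin.≟ i)) (toℕ j)
      where
      term : ∀ b j → seq (if b then fromℚ (nat (p j)) else 0ᴿ) k ≡ nat (if b then p j else 0)
      term true  j = refl
      term false j = refl

    seq-completionTime : ∀ (σ : Solution m) k →
      seq (completionTime σ realization) k ≡ nat (makespan σ p n)
    seq-completionTime σ k = seq-max k (load σ realization) (loadℕ σ p n) λ i → seq-load σ i k

  -- A total of `m * c` forces every makespan to be at least `c`, so the given `τ` is optimal and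
  -- the optimum is exactly `c`.
  ratio : ∀ {m} .{{_ : NonZero m}} c .{{_ : NonZero c}} →
          (∃[ τ ] makespan {m} τ p n ≤ c) → ∑< n p ≡ m * c →
          ∀ σ → Ratio {m} σ (fromℚ (ℤ.+ makespan σ p n ℚ./ c))
  ratio {m} c (τ , τ≤c) total σ =
    realization , fromℚ (nat c) ,
    ( (τ , ≡⇒≈ᴿ {completionTime τ realization} {fromℚ (nat c)} λ k →
        trans (seq-completionTime τ k)
              (cong nat (≤-antisym τ≤c (average≤makespan {p = p} {n} total τ))))
    , λ τ → ≤⇒≤ᴿ {fromℚ (nat c)} {completionTime τ realization} λ k →
        ℚ.≤-trans (nat-mono-≤ (average≤makespan {p = p} {n} total τ))
                  (ℚ.≤-reflexive (sym (seq-completionTime τ k)))) ,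
    (nat 1 , ℚ.positive⁻¹ (nat 1) , 0 , λ _ _ →
      ℚ.≤-trans (ℚ.≤-reflexive (ℚ.+-identityˡ (nat 1))) (nat-mono-≤ (>-nonZero⁻¹ c))) ,
    ≡⇒≈ᴿ {fromℚ (ℤ.+ makespan σ p n ℚ./ c) *ᴿ fromℚ (nat c)} {completionTime σ realization} λ k →
      trans (/-*-cancel (makespan σ p n) c) (sym (seq-completionTime σ k))

-- Rational estimates and the supremum

numerator≤ : ∀ i → i ℤ.≤ ℤ.+ ∣ i ∣
numerator≤ (ℤ.+ n)    = ℤ.≤-refl
numerator≤ ℤ.-[1+ n ] = ℤ.-≤+

-- Cross-multiplication. The absolute value of the numerator only strengthens the hypothesis and
-- keeps it within ℕ.
≤/+1/ : ∀ a C c e .{{_ : NonZero c}} .{{_ : NonZero e}} →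
        ∣ ↥ a ∣ * (c * e) ≤ (C * e + c) * ↧ₙ a → a ℚ.≤ (ℤ.+ C ℚ./ c) ℚ.+ (ℤ.1ℤ ℚ./ e)
≤/+1/ a@record{} C (suc c) (suc e) h = ℚ.toℚᵘ-cancel-≤ (begin
  toℚᵘ a
    ≤⟨ *≤* bound ⟩
  mkℚᵘ (ℤ.+ C) c ℚᵘ.+ mkℚᵘ ℤ.1ℤ e
    ≃⟨ ℚᵘ.+-cong (ℚ.toℚᵘ-fromℚᵘ (mkℚᵘ (ℤ.+ C) c)) (ℚ.toℚᵘ-fromℚᵘ (mkℚᵘ ℤ.1ℤ e)) ⟨
  toℚᵘ (ℤ.+ C ℚ./ suc c) ℚᵘ.+ toℚᵘ (ℤ.1ℤ ℚ./ suc e)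
    ≃⟨ ℚ.toℚᵘ-homo-+ (ℤ.+ C ℚ./ suc c) (ℤ.1ℤ ℚ./ suc e) ⟨
  toℚᵘ ((ℤ.+ C ℚ./ suc c) ℚ.+ (ℤ.1ℤ ℚ./ suc e)) ∎)
  where
  open ℚᵘ.≤-Reasoning
  bound : ↥ a ℤ.* ℤ.+ (suc c * suc e) ℤ.≤ (ℤ.+ C ℤ.* ℤ.+ suc e ℤ.+ ℤ.1ℤ ℤ.* ℤ.+ suc c) ℤ.* ℤ.+ ↧ₙ a
  bound = ℤ.≤-trans (ℤ.*-monoʳ-≤-nonNeg (ℤ.+ (suc c * suc e)) (numerator≤ (↥ a)))
    (ℤ.≤-trans (ℤ.≤-reflexive (sym (ℤ.pos-* ∣ ↥ a ∣ (suc c * suc e))))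
    (ℤ.≤-trans (ℤ.+≤+ h) (ℤ.≤-reflexive
      (trans (ℤ.pos-* (C * suc e + suc c) (↧ₙ a)) (cong (ℤ._* ℤ.+ ↧ₙ a)
        (trans (ℤ.pos-+ (C * suc e) (suc c)) (cong₂ ℤ._+_ (ℤ.pos-* C (suc e)) (sym (ℤ.*-identityˡ (ℤ.+ suc c))))))))))

-- A positive fraction has numerator at least 1.
archimedean : ∀ ε → 0ℚ ℚ.< ε → ℤ.1ℤ ℚ./ ↧ₙ ε ℚ.≤ ε
archimedean ε@(mkℚ (ℤ.+ suc n) d _) 0<ε = ℚ.toℚᵘ-cancel-≤ (begin
  toℚᵘ (ℤ.1ℤ ℚ./ suc d)  ≃⟨ ℚ.toℚᵘ-fromℚᵘ (mkℚᵘ ℤ.1ℤ d) ⟩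
  mkℚᵘ ℤ.1ℤ d            ≤⟨ *≤* (ℤ.*-monoʳ-≤-nonNeg (ℤ.+ suc d) (ℤ.+≤+ (s≤s (z≤n {n})))) ⟩
  toℚᵘ ε                 ∎)
  where open ℚᵘ.≤-Reasoning
archimedean (mkℚ (ℤ.+ zero)  d _) 0<ε = contradiction (ℚ.positive 0<ε) λ ()
archimedean (mkℚ ℤ.-[1+ n ] d _) 0<ε = contradiction (ℚ.positive 0<ε) λ ()

+-cancelʳ-≤ᵠ : ∀ r {p q} → p ℚ.+ r ℚ.≤ q ℚ.+ r → p ℚ.≤ q
+-cancelʳ-≤ᵠ r p+r≤q+r = ℚ.≮⇒≥ λ q<p → ℚ.<-irrefl refl (ℚ.<-≤-trans (ℚ.+-monoˡ-< r q<p) p+r≤q+r)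

-- The gap `ε` between `x` and `a` is halved: one half pays for the error `1/e`, with `e` the
-- denominator of `ε/2`, and the other half remains as the gap between `x` and the ratio.
≤sup-ratio : ∀ {m} (σ : Solution m) a →
  (∀ e .{{_ : NonZero e}} → ∃[ ρ ] Ratio σ (fromℚ ρ) × a ℚ.≤ ρ ℚ.+ (ℤ.1ℤ ℚ./ e)) →
  CompetitiveRatioAtLeast (fromℚ a) σ
≤sup-ratio σ a approximate x (ε , 0<ε , N , x+ε≤a) =
  let ρ , ratio , a≤ρ+1/e = approximate (↧ₙ δ)
  in fromℚ ρ , ratio , δ , 0<δ , N , λ n N≤n → +-cancelʳ-≤ᵠ δ {seq x n ℚ.+ δ} {ρ} (begin
    seq x n ℚ.+ δ ℚ.+ δ             ≡⟨ ℚ.+-assoc (seq x n) δ δ ⟩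
    seq x n ℚ.+ (δ ℚ.+ δ)           ≡⟨ cong (seq x n ℚ.+_) δ+δ≡ε ⟩
    seq x n ℚ.+ ε                   ≤⟨ x+ε≤a n N≤n ⟩
    a                               ≤⟨ a≤ρ+1/e ⟩
    ρ ℚ.+ (ℤ.1ℤ ℚ./ ↧ₙ δ)           ≤⟨ ℚ.+-monoʳ-≤ ρ (archimedean δ 0<δ) ⟩
    ρ ℚ.+ δ                         ∎)
  where
  open ℚ.≤-Reasoning
  δ : ℚ
  δ = ½ ℚ.* ε
  0<δ : 0ℚ ℚ.< δ
  0<δ = ℚ.positive⁻¹ _ {{ℚ.pos*pos⇒pos ½ ε {{ℚ.positive 0<ε}}}}
  δ+δ≡ε : δ ℚ.+ δ ≡ ε
  δ+δ≡ε = trans (sym (ℚ.*-distribʳ-+ ε ½ ½)) (ℚ.*-identityˡ ε)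

-- Realizations with two sizes

indicator : ℕ → Job → ℕ
indicator h j = if does (j <? h) then 1 else 0

indicator-< : ∀ {h j} → j < h → indicator h j ≡ 1
indicator-< {h} {j} j<h = cong (λ b → if b then 1 else 0) (dec-true (j <? h) j<h)

indicator-≥ : ∀ {h j} → h ≤ j → indicator h j ≡ 0
indicator-≥ {h} {j} h≤j = cong (λ b → if b then 1 else 0) (dec-false (j <? h) (≤⇒≯ h≤j))

indicator-decreasing : ∀ h j → indicator h (suc j) ≤ indicator h j
indicator-decreasing h j with j <? h
... | yes j<h = ≤-trans (bounded (suc j)) (≤-reflexive (sym (indicator-< j<h)))
  where
  bounded : ∀ j → indicator h j ≤ 1
  bounded j with does (j <? h)
  ... | true  = ≤-refl
  ... | false = z≤n
... | no  j≮h = ≤-trans (≤-reflexive (indicator-≥ (m≤n⇒m≤1+n (≮⇒≥ j≮h)))) z≤n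

∑<-indicator-≤ : ∀ {h} j → j ≤ h → ∑< j (indicator h) ≡ j
∑<-indicator-≤ {h} zero    _   = refl
∑<-indicator-≤ {h} (suc j) j<h = begin
  ∑< (suc j) (indicator h)         ≡⟨ ∑<-suc j (indicator h) ⟩
  ∑< j (indicator h) + indicator h j ≡⟨ cong₂ _+_ (∑<-indicator-≤ j (<⇒≤ j<h)) (indicator-< j<h) ⟩
  j + 1                            ≡⟨ +-comm j 1 ⟩
  suc j                            ∎
  where open ≡-Reasoning

∑<-indicator-+ : ∀ h t → ∑< (h + t) (indicator h) ≡ h
∑<-indicator-+ h zero rewrite +-identityʳ h = ∑<-indicator-≤ h ≤-refl
∑<-indicator-+ h (suc t) rewrite +-suc h t = begin
  ∑< (suc (h + t)) (indicator h)                 ≡⟨ ∑<-suc (h + t) (indicator h) ⟩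
  ∑< (h + t) (indicator h) + indicator h (h + t) ≡⟨ cong₂ _+_ (∑<-indicator-+ h t) (indicator-≥ (m≤m+n h t)) ⟩
  h + 0                                          ≡⟨ +-identityʳ h ⟩
  h                                              ∎
  where open ≡-Reasoning

∑<-linear : ∀ n f c g → ∑< n (λ j → f j + c * g j) ≡ ∑< n f + c * ∑< n g
∑<-linear n f c g =
  trans (∑-distrib-+ {n} (f ∘ toℕ) (λ j → c * g (toℕ j)))
        (cong (∑< n f +_) (sym (*-distribˡ-sum {n} c (g ∘ toℕ))))

Approximated : ∀ {m} → Solution m → ℚ → (e : ℕ) → .{{NonZero e}} → Set
Approximated σ a e = ∃[ ρ ] Ratio σ (fromℚ ρ) × a ℚ.≤ ρ ℚ.+ (ℤ.1ℤ ℚ./ e)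

-- h jobs of size k = 1 + k′ are followed by k s jobs of size 1. The optimum is
-- c = (1 + g′) k: each of the (1 + g′) m = h + s slots of length k takes a
-- single job of size k or k jobs of size 1.
module TwoSizes {m : ℕ} .{{_ : NonZero m}} (h s g′ k′ : ℕ) where

  n c : ℕ
  n = h + suc k′ * s
  c = suc g′ * suc k′

  -- A big job of size `1 + k′` is split into 1 and `k′`, which makes prefix sums and loads linear
  -- in the two indicators; `weight` is the matching split of a load.
  p : Job → ℕ
  p j = indicator n j + k′ * indicator h j

  weight : Solution m → Fin m → ℕ
  weight σ i = count σ n i + k′ * count σ h i

  h≤n : h ≤ n
  h≤n = m≤m+n h _

  size-big : ∀ {j} → j < h → p j ≡ suc k′
  size-big j<h = cong₂ _+_ (indicator-< (<-≤-trans j<h h≤n))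
    (trans (cong (k′ *_) (indicator-< j<h)) (*-identityʳ k′))

  size-small : ∀ {j} → h ≤ j → p j ≡ indicator n j
  size-small {j} h≤j =
    trans (cong (λ x → indicator n j + k′ * x) (indicator-≥ h≤j))
          (trans (cong (indicator n j +_) (*-zeroʳ k′)) (+-identityʳ _))

  prefix : ∀ j → ∑< j p ≡ ∑< j (indicator n) + k′ * ∑< j (indicator h)
  prefix j = ∑<-linear j (indicator n) k′ (indicator h)

  decreasing′ : ∀ j → p (suc j) ≤ p j
  decreasing′ j = +-mono-≤ (indicator-decreasing n j)
    (*-monoʳ-≤ k′ (indicator-decreasing h j))

  vanishing′ : ∀ j → n ≤ j → p j ≡ 0
  vanishing′ j n≤j = trans (size-small (≤-trans h≤n n≤j)) (indicator-≥ n≤j)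

  positive : ∀ j → j < n → 0 < p j
  positive j j<n = ≤-trans (≤-reflexive (sym (indicator-< j<n))) (m≤m+n _ _)

  prefix-big : ∀ {j} → j < h → ∑< j p ≡ j * suc k′
  prefix-big {j} j<h = begin
    ∑< j p                                     ≡⟨ prefix j ⟩
    ∑< j (indicator n) + k′ * ∑< j (indicator h)
      ≡⟨ cong₂ (λ x y → x + k′ * y) (∑<-indicator-≤ j (≤-trans (<⇒≤ j<h) h≤n)) (∑<-indicator-≤ j (<⇒≤ j<h)) ⟩
    suc k′ * j                                    ≡⟨ *-comm (suc k′) j ⟩
    j * suc k′                                    ∎
    where open ≡-Reasoning

  -- The big jobs come first, so each is preceded only by jobs of its own size; the others have size
  -- 1.
  size∣prefix : ∀ j → j < n → p j ∣ ∑< j p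
  size∣prefix j j<n with j <? h
  ... | yes j<h = subst₂ _∣_ (sym (size-big j<h)) (sym (prefix-big j<h)) (n∣m*n j)
  ... | no  j≮h = subst (_∣ ∑< j p) (sym (trans (size-small (≮⇒≥ j≮h)) (indicator-< j<n))) (1∣ _)

  size∣c : ∀ j → j < n → p j ∣ c
  size∣c j j<n with j <? h
  ... | yes j<h = subst (_∣ c) (sym (size-big j<h)) (n∣m*n (suc g′))
  ... | no  j≮h = subst (_∣ c) (sym (trans (size-small (≮⇒≥ j≮h)) (indicator-< j<n))) (1∣ _)

  load-linear : ∀ (σ : Solution m) i →
    loadℕ σ p n i ≡ loadℕ σ (indicator n) n i + k′ * loadℕ σ (indicator h) n i
  load-linear σ i = trans (sum-cong-≗ {n} λ j → term (does (σ (toℕ j) Fin.≟ i)) (toℕ j))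
    (∑<-linear n (share σ (indicator n) i) k′ (share σ (indicator h) i))
    where
    term : ∀ b j → (if b then p j else 0) ≡
      (if b then indicator n j else 0) + k′ * (if b then indicator h j else 0)
    term true  j = refl
    term false j = sym (*-zeroʳ k′)

  count≤load : ∀ (σ : Solution m) i {l} → l ≤ n → count σ l i ≤ loadℕ σ (indicator l) n i
  count≤load σ i {l} l≤n = ∑<-mono (share σ (const 1) i) (share σ (indicator l) i) l≤n
    λ j j<l → ≤-reflexive (cong (λ x → if does (σ j Fin.≟ i) then x else 0) (sym (indicator-< j<l)))

  weight≤makespan : ∀ σ i → weight σ i ≤ makespan σ p n
  weight≤makespan σ i = begin
    weight σ i        ≤⟨ +-mono-≤ (count≤load σ i ≤-refl) (*-monoʳ-≤ k′ (count≤load σ i h≤n)) ⟩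
    loadℕ σ (indicator n) n i + k′ * loadℕ σ (indicator h) n i ≡⟨ load-linear σ i ⟨
    loadℕ σ p n i  ≤⟨ foldr⊔-upper (loadℕ σ p n) i ⟩
    makespan σ p n ∎
    where open ≤-Reasoning

  module _ (slots : h + s ≡ suc g′ * m) where

    total : ∑< n p ≡ m * c
    total = begin
      ∑< n p                                     ≡⟨ prefix n ⟩
      ∑< n (indicator n) + k′ * ∑< n (indicator h)
        ≡⟨ cong₂ (λ x y → x + k′ * y) (∑<-indicator-≤ n ≤-refl) (∑<-indicator-+ h (suc k′ * s)) ⟩
      n + k′ * h
        ≡⟨ solve 3 (λ h s k → (h :+ (con 1 :+ k) :* s) :+ k :* h := (con 1 :+ k) :* (h :+ s)) refl h s k′ ⟩
      suc k′ * (h + s)                              ≡⟨ cong (suc k′ *_) slots ⟩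
      suc k′ * (suc g′ * m)
        ≡⟨ solve 3 (λ k g m → k :* (g :* m) := m :* (g :* k)) refl (suc k′) (suc g′) m ⟩
      m * c                                         ∎
      where
      open ≡-Reasoning
      open +-*-Solver

    approximated : ∀ σ i a e .{{_ : NonZero e}} →
      ∣ ↥ a ∣ * (c * e) ≤ (weight σ i * e + c) * ↧ₙ a → Approximated σ a e
    approximated σ i a e bound =
      ℤ.+ makespan σ p n ℚ./ c ,
      ratio c (τ , makespan≤c) total σ ,
      ≤/+1/ a (makespan σ p n) c e (≤-trans bound
        (*-monoˡ-≤ (↧ₙ a) (+-monoˡ-≤ c (*-monoˡ-≤ e (weight≤makespan σ i)))))
      where
      open Integral p n decreasing′ vanishing′
      open Packing {m} p n c positive size∣prefix size∣c (≤-reflexive total)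

    -- Disposes of solutions that are not folded: one machine of load at least 3/2 times `c`
    -- suffices for every target up to 3/2, whatever the tolerance.
    approximated-3/2 : ∀ σ i a e .{{_ : NonZero e}} → 2 * ∣ ↥ a ∣ ≤ 3 * ↧ₙ a →
      3 * c ≤ 2 * weight σ i → Approximated σ a e
    approximated-3/2 σ i a e a≤3/2 heavy =
      approximated σ i a e (*-cancelˡ-≤ 2 (begin
        2 * (r * (c * e))               ≡⟨ solve 4 (λ t r c e → t :* (r :* (c :* e)) := t :* r :* (c :* e)) refl 2 r c e ⟩
        2 * r * (c * e)                 ≤⟨ *-monoˡ-≤ (c * e) a≤3/2 ⟩
        3 * d * (c * e)                 ≡⟨ solve 4 (λ t d c e → t :* d :* (c :* e) := t :* c :* (e :* d)) refl 3 d c e ⟩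
        3 * c * (e * d)                 ≤⟨ *-monoˡ-≤ (e * d) heavy ⟩
        2 * weight σ i * (e * d)        ≡⟨ solve 4 (λ t w e d → t :* w :* (e :* d) := t :* (w :* e :* d)) refl 2 (weight σ i) e d ⟩
        2 * (weight σ i * e * d)        ≤⟨ *-monoʳ-≤ 2 (*-monoˡ-≤ d (m≤m+n (weight σ i * e) c)) ⟩
        2 * ((weight σ i * e + c) * d)  ∎))
      where
      open ≤-Reasoning
      open +-*-Solver
      r d : ℕ
      r = ∣ ↥ a ∣
      d = ↧ₙ a

-- The first 2m jobs

-- If `y` were missed, punching it out would leave an injection into a set with one element less.
injective⇒covers : ∀ {m} (f : Fin m → Fin m) → (∀ {x y} → f x ≡ f y → x ≡ y) →
                   ∀ y → ∃[ x ] f x ≡ y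
injective⇒covers {suc m} f f-injective y with Fin.any? (λ x → f x Fin.≟ y)
... | yes hit = hit
... | no miss = contradiction (Fin.injective⇒≤ punched-injective) 1+n≰n
  where
  y≢f : ∀ x → ¬ y ≡ f x
  y≢f x y≡fx = miss (x , sym y≡fx)
  punched-injective : ∀ {x x′} → punchOut (y≢f x) ≡ punchOut (y≢f x′) → x ≡ x′
  punched-injective {x} {x′} eq = f-injective (Fin.punchOut-injective (y≢f x) (y≢f x′) eq)

-- Jobs are counted from 0, so the partner of job `a` is `m + s` with `a + suc s ≡ m`. The range of
-- `j` in `no-early` stops just before it.
module Folding {m : ℕ} (σ : Solution m)
  (no-early : ∀ a s j → a + suc s ≡ m → a < j → j < m + s → ¬ σ j ≡ σ a)
  (no-triple : ∀ {a b c} → a < b → b < c → c < m + m → σ b ≡ σ a → ¬ σ c ≡ σ a) where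

  distinct : ∀ {a b} → a < b → b < m → ¬ σ a ≡ σ b
  distinct {a} {b} a<b b<m σa≡σb with m≤n⇒∃[o]m+o≡n (<-trans a<b b<m)
  ... | s , 1+a+s≡m =
    no-early a s b (trans (+-suc a s) 1+a+s≡m) a<b (<-≤-trans b<m (m≤m+n m s)) (sym σa≡σb)

  covers : ∀ i → ∃[ b ] σ (toℕ {m} b) ≡ i
  covers = injective⇒covers (σ ∘ toℕ) injective
    where
    injective : ∀ {x y : Fin m} → σ (toℕ x) ≡ σ (toℕ y) → x ≡ y
    injective {x} {y} eq with Fin.<-cmp x y
    ... | tri< x<y _ _ = contradiction eq (distinct x<y (Fin.toℕ<n y))
    ... | tri≈ _ x≡y _ = x≡y
    ... | tri> _ _ y<x = contradiction (sym eq) (distinct y<x (Fin.toℕ<n x))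

  -- Strong induction on `t`, that is, from `a = m - 1` downwards. Job `m + t` shares its machine
  -- with some `b < m`. If `b < a`, it comes too early for `b`. If `a < b`, the partner of `b` is
  -- already there by induction, and `m + t` is a third job.
  folded : ∀ t a → a + suc t ≡ m → σ (m + t) ≡ σ a
  folded = <-rec _ step
    where
    step : ∀ t → (∀ {t′} → t′ < t → ∀ a → a + suc t′ ≡ m → σ (m + t′) ≡ σ a) →
           ∀ a → a + suc t ≡ m → σ (m + t) ≡ σ a
    step t rec a a+1+t≡m with covers (σ (m + t))
    ... | b , σb≡ with m≤n⇒∃[o]m+o≡n (Fin.toℕ<n b) | <-cmp (toℕ b) a
    ... | s , 1+b+s≡m | tri< b<a _ _ =
      contradiction (sym σb≡) (no-early (toℕ b) s (m + t) b+1+s≡m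
        (<-≤-trans (Fin.toℕ<n b) (m≤m+n m t)) (+-monoʳ-< m t<s))
      where
      b+1+s≡m : toℕ b + suc s ≡ m
      b+1+s≡m = trans (+-suc (toℕ b) s) 1+b+s≡m
      t<s : t < s
      t<s = ≰⇒> λ s≤t → <-irrefl (trans b+1+s≡m (sym a+1+t≡m)) (+-mono-<-≤ b<a (s≤s s≤t))
    ... | s , 1+b+s≡m | tri≈ _ b≡a _ = trans (sym σb≡) (cong σ b≡a)
    ... | s , 1+b+s≡m | tri> _ _ a<b =
      contradiction (sym σb≡) (no-triple (<-≤-trans (Fin.toℕ<n b) (m≤m+n m s)) (+-monoʳ-< m s<t)
        (+-monoʳ-< m t<m) (rec s<t (toℕ b) b+1+s≡m))
      where
      b+1+s≡m : toℕ b + suc s ≡ m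
      b+1+s≡m = trans (+-suc (toℕ b) s) 1+b+s≡m
      s<t : s < t
      s<t = ≰⇒> λ t≤s → <-irrefl (trans a+1+t≡m (sym b+1+s≡m)) (+-mono-<-≤ a<b (s≤s t≤s))
      t<m : t < m
      t<m = ≤-trans (m≤n+m (suc t) a) (≤-reflexive a+1+t≡m)

-- Sand

-- The three realizations of the header, in the same order.
data Kind : Set where
  single paired uniform : Kind

-- `ownBig` is the number of big jobs that the machine of job `a` is sure to hold when the solution
-- is folded. Slots are stored less one to match `g′`.
slotsPerMachine-1 ownBig : Kind → ℕ
slotsPerMachine-1 single  = 0
slotsPerMachine-1 paired  = 1
slotsPerMachine-1 uniform = 0
ownBig single  = 1
ownBig paired  = 2
ownBig uniform = 0

-- The least of the three bounds of the header when x = 3/2.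
kind : ℕ → ℕ → Kind
kind m a with does (3 * suc a ≤? 2 * m) | does (2 * m ≤? 3 * a)
... | true  | _     = single
... | false | true  = paired
... | false | false = uniform

module _ (m : ℕ) where

  bigJobs sandSlots : Kind → ℕ → ℕ
  bigJobs single  a = suc a
  bigJobs paired  a = m + (m ∸ a)
  bigJobs uniform a = 0
  sandSlots single  a = m ∸ suc a
  sandSlots paired  a = a
  sandSlots uniform a = m

  slots : ∀ κ {a} → a < m → bigJobs κ a + sandSlots κ a ≡ suc (slotsPerMachine-1 κ) * m
  slots single  a<m = trans (m+[n∸m]≡n a<m) (sym (+-identityʳ m))
  slots paired  {a} a<m = trans (+-assoc m (m ∸ a) a)
    (cong (m +_) (trans (m∸n+n≡m (<⇒≤ a<m)) (sym (+-identityʳ m))))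
  slots uniform a<m = sym (+-identityʳ m)

  κ : Fin m → Kind
  κ a = kind m (toℕ a)

  -- `m !` is a common multiple of the sand slot counts, and `l a` is the factor `1 / s a` scaled by
  -- it. `suc (pred _)` is a syntactically nonzero divisor; the first condition of `Balanced`
  -- confirms that the division by `s a` is exact.
  s l gl bl : Fin m → ℕ
  s a = sandSlots (κ a) (toℕ a)
  l a = m ! / suc (pred (s a))
  gl a = suc (slotsPerMachine-1 (κ a)) * l a
  bl a = ownBig (κ a) * l a

  -- The inequality is ∑ₐ (x gₐ - bₐ) / sₐ ≤ 1 times m!, with g, b, s the slots
  -- per machine, the big jobs on the machine of a, and the slots left for sand.
  Balanced : ℚ → Set
  Balanced x = (∀ a → l a * s a ≡ m !) × ∣ ↥ x ∣ * sum gl ≤ (m ! + sum bl) * ↧ₙ x × 2 * ∣ ↥ x ∣ ≤ 3 * ↧ₙ x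

  balanced? : ∀ x → Dec (Balanced x)
  balanced? x = Fin.all? (λ a → l a * s a ≟ m !)
    ×-dec ∣ ↥ x ∣ * sum gl ≤? (m ! + sum bl) * ↧ₙ x ×-dec 2 * ∣ ↥ x ∣ ≤? 3 * ↧ₙ x

-- The lower bound for one solution

expand-budget : ∀ L B d e q G → (L + B) * d * (e * q) + q * d * G ≡
                e * d * (q * L) + (q * e * d * B + q * d * G)
expand-budget = solve 6 (λ L B d e q G → (L :+ B) :* d :* (e :* q) :+ q :* d :* G
  := e :* d :* (q :* L) :+ (q :* e :* d :* B :+ q :* d :* G)) refl
  where open +-*-Solver

-- `q` refines the sand, and `2 * m * e < q` makes a loss of 2 per machine negligible against the
-- tolerance `1/e`.
module LowerBound {m : ℕ} .{{_ : NonZero m}} (x : ℚ) (balanced : Balanced m x)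
                  (σ : Solution m) (e : ℕ) .{{_ : NonZero e}}
                  (q : ℕ) (2me<q : 2 * m * e < q) where

  r d : ℕ
  r = ∣ ↥ x ∣
  d = ↧ₙ x

  -- Sizes 2 and 1 with optimum 2: `Even` has `2m` jobs of size 1, and `Early a` has `a + 1` jobs of
  -- size 2, then jobs of size 1 up to the one before the partner of `a`.
  module Even   = TwoSizes {m} 0 m 0 1
  module Early (a : Fin m) = TwoSizes {m} (suc (toℕ a)) (m ∸ suc (toℕ a)) 0 1

  l*s≡m! : ∀ a → l m a * s m a ≡ m !
  l*s≡m! = proj₁ balanced

  l-nonZero : ∀ a → NonZero (l m a)
  l-nonZero a = m*n≢0⇒m≢0 (l m a) {{subst NonZero (sym (l*s≡m! a)) (m !≢0)}}

  -- With the size ratio `q * l m a`, the `s m a` slots take `q * m !` grains of sand. This number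
  -- `T` is the same for every `a`, so the realizations can be compared on the same jobs.
  k′ : Fin m → ℕ
  k′ a = pred (q * l m a)

  k≡ : ∀ a → suc (k′ a) ≡ q * l m a
  k≡ a = suc-pred (q * l m a) {{m*n≢0 q (l m a) {{>-nonZero (≤-<-trans z≤n 2me<q)}} {{l-nonZero a}}}}

  module Sand (a : Fin m) =
    TwoSizes {m} (bigJobs m (κ m a) (toℕ a)) (s m a) (slotsPerMachine-1 (κ m a)) (k′ a)

  machine : Fin m → Fin m
  machine a = σ (toℕ a)

  T : ℕ
  T = q * m !

  module WhenFolded (covers : ∀ i → ∃[ a ] machine a ≡ i)
                    (folded : ∀ t a → a + suc t ≡ m → σ (m + t) ≡ σ a) where

    -- In the paired case the number `2m - a` of big jobs is just large enough to include the
    -- partner `2m - 1 - a` of job `a`.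
    ownBig≤count : ∀ κ (a : Fin m) → ownBig κ ≤ count σ (bigJobs m κ (toℕ a)) (machine a)
    ownBig≤count single  a = ≤-trans (s≤s z≤n) (count-hit σ {suc (toℕ a)} ≤-refl refl)
    ownBig≤count uniform a = z≤n
    ownBig≤count paired  a = begin
      2                                      ≤⟨ s≤s (≤-trans (s≤s z≤n) (count-hit σ {m + t} a<m+t refl)) ⟩
      suc (count σ (m + t) (machine a))      ≤⟨ count-hit σ {m + (m ∸ toℕ a)} (+-monoʳ-< m t<m∸a) (folded t (toℕ a) a+1+t≡m) ⟩
      count σ (m + (m ∸ toℕ a)) (machine a)  ∎
      where
      open ≤-Reasoning
      t : ℕ
      t = m ∸ suc (toℕ a)
      a+1+t≡m : toℕ a + suc t ≡ m
      a+1+t≡m = trans (+-suc (toℕ a) t) (m+[n∸m]≡n (Fin.toℕ<n a))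
      a<m+t : toℕ a < m + t
      a<m+t = <-≤-trans (Fin.toℕ<n a) (m≤m+n m t)
      t<m∸a : t < m ∸ toℕ a
      t<m∸a = ∸-monoʳ-< ≤-refl (Fin.toℕ<n a)

    T≤n : ∀ a → T ≤ Sand.n a
    T≤n a = begin
      q * m !                 ≡⟨ cong (q *_) (l*s≡m! a) ⟨
      q * (l m a * s m a)     ≡⟨ *-assoc q (l m a) (s m a) ⟨
      q * l m a * s m a       ≡⟨ cong (_* s m a) (k≡ a) ⟨
      suc (k′ a) * s m a      ≤⟨ m≤n+m _ (bigJobs m (κ m a) (toℕ a)) ⟩
      Sand.n a                ∎
      where open ≤-Reasoning

    ownBig≤2 : ∀ κ → ownBig κ ≤ 2
    ownBig≤2 single  = s≤s z≤n
    ownBig≤2 paired  = ≤-refl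
    ownBig≤2 uniform = z≤n

    -- The first `T` jobs stand in for the sand, although some of them may be big.
    N w : Fin m → ℕ
    N a = count σ T (machine a)
    w a = Sand.weight a σ (machine a)

    -- The unit part of the own big jobs may already be counted in `N a`; this double counting costs
    -- at most `ownBig`, hence at most 2.
    weight-bound : ∀ a → N a + q * bl m a ≤ w a + 2
    weight-bound a = begin
      N a + q * (b * l m a)           ≡⟨ solve 4 (λ N q b l → N :+ q :* (b :* l) := N :+ q :* l :* b) refl (N a) q b (l m a) ⟩
      N a + q * l m a * b             ≡⟨ cong (λ k → N a + k * b) (k≡ a) ⟨
      N a + suc (k′ a) * b            ≡⟨ solve 3 (λ N k b → N :+ (con 1 :+ k) :* b := N :+ k :* b :+ b) refl (N a) (k′ a) b ⟩
      N a + k′ a * b + b              ≤⟨ +-mono-≤ (+-mono-≤ (∑<-extend (share σ (const 1) (machine a)) (T≤n a))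
                                                          (*-monoʳ-≤ (k′ a) (ownBig≤count (κ m a) a)))
                                               (ownBig≤2 (κ m a)) ⟩
      w a + 2                         ∎
      where
      open ≤-Reasoning
      open +-*-Solver
      b : ℕ
      b = ownBig (κ m a)

    T≤∑N : T ≤ sum N
    T≤∑N = begin
      T                   ≡⟨ *-identityʳ T ⟨
      T * 1               ≡⟨ sum-const T 1 ⟨
      ∑< T (const 1)      ≤⟨ total≤loads σ (const 1) T machine (covers ∘ σ) ⟩
      sum N               ∎
      where open ≤-Reasoning

    -- `Y a ≤ X a` is the hypothesis of `Sand.approximated`. Comparing the sums is enough, as then
    -- some `a` satisfies it.
    X Y : Fin m → ℕ
    X a = (w a * e + Sand.c a) * d
    Y a = r * (Sand.c a * e)

    c≡ : ∀ a → Sand.c a ≡ q * gl m a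
    c≡ a = trans (cong (g *_) (k≡ a))
      (solve 3 (λ g q l → g :* (q :* l) := q :* (g :* l)) refl g q (l m a))
      where
      open +-*-Solver
      g : ℕ
      g = suc (slotsPerMachine-1 (κ m a))

    X-bound : ∀ a → e * d * N a + (q * e * d * bl m a + q * d * gl m a) ≤ X a + 2 * (e * d)
    X-bound a = begin
      e * d * N a + (q * e * d * bl m a + q * d * gl m a)
        ≡⟨ solve 6 (λ e d q N b g → e :* d :* N :+ (q :* e :* d :* b :+ q :* d :* g)
                      := ((N :+ q :* b) :* e :+ q :* g) :* d) refl e d q (N a) (bl m a) (gl m a) ⟩
      ((N a + q * bl m a) * e + q * gl m a) * d
        ≤⟨ *-monoˡ-≤ d (+-monoˡ-≤ (q * gl m a) (*-monoˡ-≤ e (weight-bound a))) ⟩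
      ((w a + 2) * e + q * gl m a) * d
        ≡⟨ cong (λ c → ((w a + 2) * e + c) * d) (c≡ a) ⟨
      ((w a + 2) * e + Sand.c a) * d
        ≡⟨ solve 4 (λ w e d c → ((w :+ con 2) :* e :+ c) :* d := (w :* e :+ c) :* d :+ con 2 :* (e :* d)) refl (w a) e d (Sand.c a) ⟩
      X a + 2 * (e * d) ∎
      where
      open ≤-Reasoning
      open +-*-Solver

    L G B : ℕ
    L = m !
    G = sum (gl m)
    B = sum (bl m)

    ∑Y : sum Y ≡ r * G * (e * q)
    ∑Y = begin
      sum Y
        ≡⟨ sum-cong-≗ (λ a → trans (cong (λ c → r * (c * e)) (c≡ a))
             (solve 4 (λ r q g e → r :* (q :* g :* e) := r :* (e :* q) :* g) refl r q (gl m a) e)) ⟩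
      sum (λ a → r * (e * q) * gl m a)  ≡⟨ *-distribˡ-sum (r * (e * q)) (gl m) ⟨
      r * (e * q) * G                   ≡⟨ solve 3 (λ r x g → r :* x :* g := r :* g :* x) refl r (e * q) G ⟩
      r * G * (e * q)                   ∎
      where
      open ≡-Reasoning
      open +-*-Solver

    ∑X : e * d * sum N + (q * e * d * B + q * d * G) ≤ sum X + m * (2 * (e * d))
    ∑X = begin
      e * d * sum N + (q * e * d * B + q * d * G)
        ≡⟨ cong₂ _+_ (*-distribˡ-sum (e * d) N)
             (cong₂ _+_ (*-distribˡ-sum (q * e * d) (bl m)) (*-distribˡ-sum (q * d) (gl m))) ⟩
      sum f₁ + (sum f₂ + sum f₃)           ≡⟨ cong (sum f₁ +_) (∑-distrib-+ f₂ f₃) ⟨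
      sum f₁ + sum (λ a → f₂ a + f₃ a)     ≡⟨ ∑-distrib-+ f₁ (λ a → f₂ a + f₃ a) ⟨
      sum (λ a → f₁ a + (f₂ a + f₃ a))     ≤⟨ sum-mono X-bound ⟩
      sum (λ a → X a + 2 * (e * d))        ≡⟨ ∑-distrib-+ X (const (2 * (e * d))) ⟩
      sum X + sum {m} (const (2 * (e * d))) ≡⟨ cong (sum X +_) (sum-const m _) ⟩
      sum X + m * (2 * (e * d))            ∎
      where
      open ≤-Reasoning
      f₁ f₂ f₃ : Fin m → ℕ
      f₁ a = e * d * N a
      f₂ a = q * e * d * bl m a
      f₃ a = q * d * gl m a

    G>0 : 0 < G
    G>0 = begin-strict
      0            <⟨ >-nonZero⁻¹ (l m a₀) {{l-nonZero a₀}} ⟩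
      l m a₀       ≤⟨ m≤m+n (l m a₀) _ ⟩
      gl m a₀      ≤⟨ term≤sum (gl m) a₀ ⟩
      G            ∎
      where
      open ≤-Reasoning
      a₀ : Fin m
      a₀ = fromℕ< {0} (>-nonZero⁻¹ m)

    error-small : m * (2 * (e * d)) < q * d * G
    error-small = begin-strict
      m * (2 * (e * d))      ≡⟨ solve 3 (λ m e d → m :* (con 2 :* (e :* d)) := con 2 :* m :* e :* d) refl m e d ⟩
      2 * m * e * d          <⟨ *-monoˡ-< d 2me<q ⟩
      q * d                  ≤⟨ m≤m*n (q * d) G {{>-nonZero G>0}} ⟩
      q * d * G              ∎
      where
      open ≤-Reasoning
      open +-*-Solver

    -- The balance inequality times `e * q` covers `sum Y`; the term `q * d * G`, gained from the
    -- tolerance `1/e`, covers the accumulated loss of 2 per machine.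
    budget : sum Y + m * (2 * (e * d)) < (L + B) * d * (e * q) + q * d * G
    budget = ≤-<-trans (≤-reflexive (cong (_+ m * (2 * (e * d))) ∑Y))
      (+-mono-≤-< {r * G * (e * q)} {(L + B) * d * (e * q)}
        (*-monoˡ-≤ (e * q) (proj₁ (proj₂ balanced))) error-small)

    -- The factor `q * L` in the expanded budget is `T`, and the machines together hold at least the
    -- first `T` jobs.
    spent : (L + B) * d * (e * q) + q * d * G ≤ e * d * sum N + (q * e * d * B + q * d * G)
    spent = ≤-trans (≤-reflexive (expand-budget L B d e q G))
      (+-monoˡ-≤ (q * e * d * B + q * d * G) (*-monoʳ-≤ (e * d) T≤∑N))

    ∑Y<∑X : sum Y < sum X
    ∑Y<∑X = +-cancelʳ-< (m * (2 * (e * d))) (sum Y) (sum X)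
      (<-≤-trans budget (≤-trans spent ∑X))

    approximation : Approximated σ x e
    approximation =
      let a , Ya<Xa = sum-<⇒∃< Y X ∑Y<∑X
      in Sand.approximated a (slots m (κ m a) (Fin.toℕ<n a)) σ (machine a) x e (<⇒≤ Ya<Xa)


  -- Load 3 on a machine against the optimum 2 gives the ratio 3/2 at once. If neither `Even` nor
  -- any `Early a` produces it, both hypotheses of `Folding` hold.
  approximation : Approximated σ x e
  approximation with Fin.any? (λ i → 3 * Even.c ≤? 2 * Even.weight σ i)
            | Fin.any? (λ a → 3 * Early.c a ≤? 2 * Early.weight a σ (machine a))
  ... | yes (i , heavy) | _ =
    Even.approximated-3/2 (sym (+-identityʳ m)) σ i x e (proj₂ (proj₂ balanced)) heavy
  ... | no _ | yes (a , heavy) =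
    Early.approximated-3/2 a (slots m single (Fin.toℕ<n a)) σ (machine a) x e (proj₂ (proj₂ balanced)) heavy
  ... | no ¬even | no ¬early = WhenFolded.approximation covers folded
    where
    open ≤-Reasoning

    no-early : ∀ a s j → a + suc s ≡ m → a < j → j < m + s → ¬ σ j ≡ σ a
    no-early a s j a+1+s≡m a<j j<m+s σj≡σa = ¬early (b , *-monoʳ-≤ 2 (begin
      -- Job `a` counts in both terms of the weight and `j` in the first; the `0` is there because
      -- `1 * count` unfolds to `count + 0`.
      3                                        ≤⟨ +-mono-≤ {2} {_} {1} early-pair (m≤n⇒m≤n+o 0 early-self) ⟩
      Early.weight b σ (machine b)             ∎))
      where
      b : Fin m
      b = fromℕ< {a} (m+n≤o⇒m≤o (suc a) (≤-reflexive (trans (sym (+-suc a s)) a+1+s≡m)))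
      b≡a : toℕ b ≡ a
      b≡a = Fin.toℕ-fromℕ< _
      hit-b : machine b ≡ σ a
      hit-b = cong σ b≡a
      n≡ : Early.n b ≡ m + s
      n≡ = begin-equality
        suc (toℕ b) + 2 * t       ≡⟨ solve 2 (λ x t → x :+ con 2 :* t := (x :+ t) :+ t) refl (suc (toℕ b)) t ⟩
        suc (toℕ b) + t + t       ≡⟨ cong (_+ t) (m+[n∸m]≡n (Fin.toℕ<n b)) ⟩
        m + t                     ≡⟨ cong (m +_) (cong₂ _∸_ (trans (sym a+1+s≡m) (+-suc a s)) (cong suc b≡a)) ⟩
        m + (suc a + s ∸ suc a)   ≡⟨ cong (m +_) (m+n∸m≡n (suc a) s) ⟩
        m + s                     ∎
        where
        open +-*-Solver
        t : ℕ
        t = m ∸ suc (toℕ b)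
      early-self : 1 ≤ count σ (suc (toℕ b)) (machine b)
      early-self = ≤-trans (s≤s z≤n) (count-hit σ {suc (toℕ b)} ≤-refl refl)
      early-pair : 2 ≤ count σ (Early.n b) (machine b)
      early-pair = begin
        2                             ≤⟨ s≤s early-self ⟩
        suc (count σ (suc (toℕ b)) (machine b)) ≤⟨ s≤s (∑<-extend (share σ (const 1) (machine b)) (≤-trans (s≤s (≤-reflexive b≡a)) a<j)) ⟩
        suc (count σ j (machine b))   ≤⟨ count-hit σ {Early.n b} (<-≤-trans j<m+s (≤-reflexive (sym n≡))) (trans σj≡σa (sym hit-b)) ⟩
        count σ (Early.n b) (machine b) ∎

    no-triple : ∀ {a b c} → a < b → b < c → c < m + m → σ b ≡ σ a → ¬ σ c ≡ σ a
    no-triple {a} {b} {c} a<b b<c c<2m σb≡σa σc≡σa = ¬even (σ a , *-monoʳ-≤ 2 (begin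
      3                            ≤⟨ s≤s (s≤s (≤-trans (s≤s z≤n) (count-hit σ {b} a<b refl))) ⟩
      2 + count σ b (σ a)          ≤⟨ s≤s (count-hit σ {c} b<c σb≡σa) ⟩
      1 + count σ c (σ a)          ≤⟨ count-hit σ {Even.n} (<-≤-trans c<2m (≤-reflexive (cong (m +_) (sym (+-identityʳ m))))) σc≡σa ⟩
      count σ Even.n (σ a)         ≤⟨ m≤m+n _ _ ⟩
      Even.weight σ (σ a)          ∎))

    open Folding σ no-early no-triple

-- The values of m from 5 to 17

R-balanced : ∀ j → Balanced (5 + toℕ {13} j) (R (5 + toℕ j))
-- Only closed conditions on natural numbers remain, so evaluating the decision procedure for the
-- thirteen values settles them.
R-balanced = toWitness {a? = Fin.all? λ j → balanced? (5 + toℕ {13} j) (R (5 + toℕ j))} _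

theorem11 : ∀ (m : ℕ) → 5 ≤ m → m ≤ 17 → (σ : Solution m) → CompetitiveRatioAtLeast (fromℚ (R m)) σ
theorem11 m 5≤m m≤17 with m≤n⇒∃[o]m+o≡n 5≤m
... | j , refl = λ σ → ≤sup-ratio σ (R (5 + j)) λ e →
  -- The least `q` above `2 * m * e`.
  LowerBound.approximation (R (5 + j)) balanced σ e (suc (2 * (5 + j) * e)) ≤-refl
  where
  j<13 : j < 13
  j<13 = s≤s (+-cancelˡ-≤ 5 j 12 m≤17)
  balanced : Balanced (5 + j) (R (5 + j))
  balanced = subst (λ j → Balanced (5 + j) (R (5 + j))) (Fin.toℕ-fromℕ< j<13) (R-balanced (fromℕ< j<13))
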